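{- There exist an $s$-$t$ DAG $G=(V,E)$, a flow $X\colon E\to\mathbb N$, and $s$-$t$ paths $P_1,\dots,P_k$ that are the paths of a minimum flow decomposition of $(G,X)$ with weights in $\mathbb N$ (so $k=\mathrm{mfd}_{\mathbb N}(G,X)$), such that the linear system $w_1P_1+\dots+w_kP_k=X$ has two distinct solutions $w\in\mathbb N^k$; in particular the $|E|\times k$ $0/1$ matrix $L$ with $L_{i,j}=1$ if and only if path $P_j$ crosses edge $e_i$ has rank strictly less than $k$.
   Context: An $s$-$t$ DAG is a directed acyclic graph $G=(V,E)$ with a unique source $s$ (no in-edges) and a unique sink $t$ (no out-edges). A flow is a function $X$ on $E$ such that at every node of $V\setminus\{s,t\}$ incoming flow equals outgoing flow. An $s$-$t$ path $P$ is identified with the flow that is $1$ on the edges of $P$ and $0$ elsewhere. A flow decomposition of $(G,X)$ of size $k$ with weights in $\mathbb N$ ($0\in\mathbb N$) is a family of $s$-$t$ paths $P_1,\dots,P_k$ with weights $w_1,\dots,w_k\in\mathbb N$ such that $X=w_1P_1+\dots+w_kP_k$; $\mathrm{mfd}_{\mathbb N}(G,X)$ is the smallest size of such a decomposition, and a flow decomposition of that size is called minimum. -}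

module Defs where

open import Data.Fin.Base using (Fin)
open import Data.Fin.Properties using (_≟_)
open import Data.List.Base using (List; []; _∷_)
open import Data.List.Membership.DecPropositional using (_∈?_)
open import Data.Nat.Base as ℕ using (ℕ; _≤_)
import Data.Nat.Properties as ℕ
open import Data.Product.Base using (Σ; _×_; _,_)
open import Data.Rational.Base as ℚ using (ℚ; 0ℚ; 1ℚ)
import Data.Rational.Properties as ℚ
open import Data.Vec.Functional using (Vector)
open import Data.Bool.Base using (Bool; if_then_else_)
open import Relation.Binary.Construct.Closure.ReflexiveTransitive using (Star; ε; _◅_)
open import Relation.Binary.Construct.Closure.Transitive using (TransClosure)
open import Relation.Binary.PropositionalEquality.Core using (_≡_; _≢_)
open import Relation.Nullary.Decidable.Core using (does)
open import Relation.Nullary.Negation.Core using (¬_)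

import Algebra.Properties.Monoid.Sum ℕ.+-0-monoid as ℕΣ
import Algebra.Properties.Monoid.Sum ℚ.+-0-monoid as ℚΣ

-- Vertices and edges are enumerated; `simple` makes the edge set a subset of
-- V × V, i.e. there are no parallel edges.
record Digraph : Set where
  field
    ∣V∣ ∣E∣ : ℕ

    src tgt : Fin ∣E∣ → Fin ∣V∣
    simple  : ∀ e f → src e ≡ src f → tgt e ≡ tgt f → e ≡ f

  V E : Set
  V = Fin ∣V∣
  E = Fin ∣E∣

  Edge : V → V → Set
  Edge u v = Σ E λ e → src e ≡ u × tgt e ≡ v

  Walk : V → V → Set
  Walk = Star Edge

  Acyclic : Set
  Acyclic = ∀ v → ¬ TransClosure Edge v v

  IsSource IsSink : V → Set
  IsSource v = ∀ e → tgt e ≢ v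
  IsSink   v = ∀ e → src e ≢ v

  edges : ∀ {u v} → Walk u v → List E
  edges ε             = []
  edges ((e , _) ◅ p) = e ∷ edges p

  crosses : ∀ {u v} → Walk u v → E → Bool
  crosses p e = does (_∈?_ _≟_ e (edges p))

record STDAG : Set where
  field
    digraph : Digraph
  open Digraph digraph public
  field
    acyclic       : Acyclic
    s t           : V
    s-source      : IsSource s
    s-unique      : ∀ v → IsSource v → v ≡ s
    t-sink        : IsSink t
    t-unique      : ∀ v → IsSink v → v ≡ t

module _ (G : STDAG) where
  open STDAG G

  -- In an acyclic graph no walk repeats a vertex, so walks are paths.
  Path : Set
  Path = Walk s t

  inflow outflow : (E → ℕ) → V → ℕ
  inflow  X v = ℕΣ.sum λ e → if does (tgt e ≟ v) then X e else 0
  outflow X v = ℕΣ.sum λ e → if does (src e ≟ v) then X e else 0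

  IsFlow : (E → ℕ) → Set
  IsFlow X = ∀ v → v ≢ s → v ≢ t → inflow X v ≡ outflow X v

  pathFlow : Path → E → ℕ
  pathFlow P e = if crosses P e then 1 else 0

  Solves : ∀ {k} → (E → ℕ) → Vector Path k → Vector ℕ k → Set
  Solves X P w = ∀ e → ℕΣ.sum (λ j → w j ℕ.* pathFlow (P j) e) ≡ X e

  FlowDecomposition : (E → ℕ) → ℕ → Set
  FlowDecomposition X k = Σ (Vector Path k) λ P → Σ (Vector ℕ k) λ w → Solves X P w

  -- mfd_ℕ(G,X) = k
  IsMfd : (E → ℕ) → ℕ → Set
  IsMfd X k = FlowDecomposition X k × (∀ l → FlowDecomposition X l → k ≤ l)

  ArePathsOfMinimumDecomposition : ∀ {k} → (E → ℕ) → Vector Path k → Set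
  ArePathsOfMinimumDecomposition {k} X P = (Σ (Vector ℕ k) λ w → Solves X P w) × IsMfd X k

  pathMatrix : ∀ {k} → Vector Path k → E → Fin k → ℚ
  pathMatrix P i j = if crosses (P j) i then 1ℚ else 0ℚ

LinearlyIndependent : ∀ {m r} → (Fin r → Vector ℚ m) → Set
LinearlyIndependent {r = r} v =
  ∀ (a : Vector ℚ r) →
  (∀ i → ℚΣ.sum (λ j → a j ℚ.* v j i) ≡ 0ℚ) → ∀ j → a j ≡ 0ℚ

-- A family of r columns of M; a family with a repeated column is never
-- linearly independent, so c need not be required to be injective.
IndependentColumns : ∀ {m k r} → (Fin m → Fin k → ℚ) → (Fin r → Fin k) → Set
IndependentColumns M c = LinearlyIndependent λ j i → M i (c j)

-- Column rank over ℚ: the largest size of a linearly independent family of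
-- columns.
IsRank : ∀ {m k} → (Fin m → Fin k → ℚ) → ℕ → Set
IsRank {k = k} M r =
  (Σ (Fin r → Fin k) λ c → IndependentColumns M c) ×
  (∀ q (c : Fin q → Fin k) → IndependentColumns M c → q ≤ r)

{-# OPTIONS --safe #-}
module Submission where

-- The paths P₀ … P₇ satisfy 2 P₀ + P₂ + P₃ + P₄ = 2 P₁ + P₅ + P₆ + P₇, so
-- every solution of the linear system has the form
-- (1, 3, 3, 19, 2, 3, 39, 12) + x (2, −2, 1, 1, 1, −1, −1, −1). Increasing x
-- exchanges the first two weights 1 and 3 in one step: they vanish only at
-- x = −1/2 and x = 3/2, so no path can be dropped by moving along this line
-- in integers.
--
-- That no other 7 paths suffice is a finite search. Number the vertices
-- topologically; an s-t path then crosses every cut {0, …, c} | {c + 1, …}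
-- in exactly one edge, so a decomposition splits its multiset of weights, for
-- each cut, into blocks summing to the flow values on the cut edges. No 7
-- natural numbers can be split in the required way for all of the cuts at
-- 0, 3, 6, 9 and 12.
--
-- The rank is at most 7 because the coefficients of the relation are all
-- nonzero, and columns 1 to 7 are independent.

open import Defs
open import Data.Nat.Base using (ℕ; _<_)
open import Data.Product.Base using (Σ; _×_)
open import Data.Vec.Functional using (Vector)
open import Relation.Binary.PropositionalEquality using (_≗_)
open import Relation.Nullary.Negation using (¬_)

open import Data.Bool.Base using (Bool; true; false; if_then_else_; not; _∧_; T)
open import Data.Bool.ListAction using (all; any)
open import Data.Fin.Base using (Fin; zero; suc; toℕ; punchOut)
open import Data.Fin using (#_)
open import Data.Fin.Permutation using (permutation)
import Data.Fin.Properties as Fin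
open import Data.Fin.Properties using (_≟_)
open import Data.List.Base using (List; []; _∷_; map; length; filter; allFin; upTo; tabulate)
open import Data.List.Membership.Propositional using (_∈_)
open import Data.List.Membership.Propositional.Properties
  using (∈-map⁺; ∈-filter⁺; ∈-filter⁻; ∈-allFin; ∈-upTo⁺)
open import Data.List.Properties using (map-cong-local; map-cong; length-map; length-tabulate)
open import Data.List.Relation.Binary.Permutation.Propositional.Properties using (map⁺; ↭-length)
open import Data.List.Relation.Unary.All as All using (All; []; _∷_)
open import Data.List.Relation.Unary.All.Properties using (all⁺; all⁻)
open import Data.List.Relation.Unary.AllPairs using (AllPairs; []; _∷_)
import Data.List.Relation.Unary.AllPairs.Properties as AllPairs
open import Data.List.Relation.Unary.Any using (here; there)
import Data.List.Relation.Unary.Any as Any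
open import Data.List.Relation.Unary.Any.Properties using (any⁺)
open import Data.List.Relation.Unary.Sorted.TotalOrder.Properties using (Sorted⇒AllPairs)
import Data.List.Sort as Sort
open import Data.List.Relation.Unary.Unique.Propositional using (Unique)
open import Data.List.Relation.Unary.Unique.Propositional.Properties using (allFin⁺; filter⁺)
open import Data.Maybe.Base as Maybe using (Maybe; just; nothing; from-just)
open import Data.Nat.Base
  using (zero; suc; _+_; _*_; _∸_; _≤_; _≥_; _≤ᵇ_; _≡ᵇ_; z≤n; s≤s; s≤s⁻¹; _≤′_; ≤′-refl; ≤′-step)
open import Data.Nat.ListAction using (sum)
open import Data.Nat.ListAction.Properties using (sum-↭)
import Data.Nat.Properties as ℕ
open import Data.Product.Base using (∃; _,_; proj₁; proj₂)
open import Data.Rational.Base as ℚ using (ℚ; 0ℚ; ½; 1ℚ)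
import Data.Rational.Properties as ℚ
open import Data.Unit.Base using (tt)
open import Data.Vec.Base as Vec using (Vec; []; _∷_; lookup)
open import Function.Base using (_∘_; id)
open import Function.Definitions using (Injective)
open import Relation.Binary.Bundles using (DecTotalOrder)
import Relation.Binary.Construct.Flip.EqAndOrd as Flip
import Relation.Binary.Construct.On as On
open import Relation.Binary.Construct.Closure.ReflexiveTransitive using (ε; _◅_)
open import Relation.Binary.Construct.Closure.Transitive using (TransClosure; [_]; _∷_)
open import Relation.Binary.PropositionalEquality
  using (_≡_; _≢_; refl; sym; trans; cong; cong₂; subst; module ≡-Reasoning)
open import Relation.Nullary.Decidable
  using (Dec; does; yes; no; from-yes; dec-true; dec-false; _→-dec_; _×-dec_; ¬?)
open import Relation.Nullary.Negation using (contradiction)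

import Algebra.Properties.CommutativeMonoid.Sum ℚ.+-0-commutativeMonoid as ℚΣ
import Algebra.Properties.Group ℚ.+-0-group as ℚGroup
import Algebra.Properties.Monoid.Sum ℕ.+-0-monoid as ℕΣ

private
  variable
    k m n q u w : ℕ
    bs bs′ ws : List ℕ

-- Splitting a list of weights into blocks with prescribed sums

-- The first list is the state before `w` is taken out of a block; writing that block as `w + b`
-- avoids truncated subtraction, so no block is overdrawn.
data Place (w : ℕ) : List ℕ → List ℕ → Set where
  here  : ∀ {b}     → Place w (w + b ∷ bs) (b ∷ bs)
  there : ∀ {b} → Place w bs bs′ → Place w (b ∷ bs) (b ∷ bs′)

data Fill : List ℕ → List ℕ → Set where
  []  : All (T ∘ (_≡ᵇ 0)) bs → Fill [] bs
  _∷_ : Place w bs bs′ → Fill ws bs′ → Fill (w ∷ ws) bs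

placements : ℕ → List ℕ → List (List ℕ)
placements w []       = []
placements w (b ∷ bs) = if w ≤ᵇ b then (b ∸ w ∷ bs) ∷ later else later
  where later = map (b ∷_) (placements w bs)

fits : List ℕ → List ℕ → Bool
fits []       bs = all (_≡ᵇ 0) bs
fits (w ∷ ws) bs = any (fits ws) (placements w bs)

-- Every nonincreasing ws of length n with entries at most u and Fill ws bs
-- satisfies p. The test against sum bs only prunes the search: n weights
-- that are at most w cannot exhaust blocks of total size greater than n * w.
everyFill : ℕ → ℕ → List ℕ → (List ℕ → Bool) → Bool
everyFill zero    u bs p = if all (_≡ᵇ 0) bs then p [] else true
everyFill (suc n) u bs p = all step (upTo (suc u))
  where
  step : ℕ → Bool
  step w = if sum bs ≤ᵇ suc n * w
    then all (λ bs′ → everyFill n w bs′ (p ∘ (w ∷_))) (placements w bs)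
    else true

T⇒≡true : ∀ {b} → T b → b ≡ true
T⇒≡true {true} _ = refl

≡true⇒T : ∀ {b} → b ≡ true → T b
≡true⇒T refl = tt

≤⇒≤ᵇ≡true : m ≤ n → (m ≤ᵇ n) ≡ true
≤⇒≤ᵇ≡true = T⇒≡true ∘ ℕ.≤⇒≤ᵇ

place⇒∈placements : Place w bs bs′ → bs′ ∈ placements w bs
place⇒∈placements {w} (here {b = b}) rewrite ≤⇒≤ᵇ≡true (ℕ.m≤m+n w b) | ℕ.m+n∸m≡n w b = here refl
place⇒∈placements {w} (there {b = b} p) with w ≤ᵇ b
... | true  = there (∈-map⁺ (b ∷_) (place⇒∈placements p))
... | false = ∈-map⁺ (b ∷_) (place⇒∈placements p)

place⇒sum : Place w bs bs′ → sum bs ≡ w + sum bs′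
place⇒sum {w} (here {bs = bs} {b = b}) = ℕ.+-assoc w b (sum bs)
place⇒sum {w} (there {bs′ = bs′} {b = b} p) = begin
  b + _              ≡⟨ cong (b +_) (place⇒sum p) ⟩
  b + (w + sum bs′)  ≡⟨ ℕ.+-assoc b w (sum bs′) ⟨
  b + w + sum bs′    ≡⟨ cong (_+ sum bs′) (ℕ.+-comm b w) ⟩
  w + b + sum bs′    ≡⟨ ℕ.+-assoc w b (sum bs′) ⟩
  w + (b + sum bs′)  ∎
  where open ≡-Reasoning

fill⇒sum : Fill ws bs → sum bs ≡ sum ws
fill⇒sum ([] [])       = refl
fill⇒sum ([] (_∷_ {x = zero} _ bs≡0)) = fill⇒sum ([] bs≡0)
fill⇒sum (p ∷ f)       = trans (place⇒sum p) (cong (_ +_) (fill⇒sum f))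

fill⇒fits : Fill ws bs → T (fits ws bs)
fill⇒fits ([] bs≡0)        = all⁻ _ bs≡0
fill⇒fits (_∷_ {ws = ws} p f) =
  any⁺ (fits ws) (Any.map (λ { refl → fill⇒fits f }) (place⇒∈placements p))

sum≤length* : All (_≤ w) ws → sum ws ≤ length ws * w
sum≤length* []       = z≤n
sum≤length* (x ∷ xs) = ℕ.+-mono-≤ x (sum≤length* xs)

all≤sum : ∀ ws → All (_≤ sum ws) ws
all≤sum []       = []
all≤sum (w ∷ ws) =
  ℕ.m≤m+n w (sum ws) ∷ All.map (λ x≤ → ℕ.≤-trans x≤ (ℕ.m≤n+m (sum ws) w)) (all≤sum ws)

everyFill-sound : ∀ {p} → length ws ≡ n → AllPairs _≥_ ws → All (_≤ u) ws → Fill ws bs →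
                  everyFill n u bs p ≡ true → T (p ws)
everyFill-sound {bs = bs} refl [] [] ([] bs≡0) ok
  rewrite T⇒≡true (all⁻ (_≡ᵇ 0) bs≡0) = ≡true⇒T ok
everyFill-sound {ws = w ∷ ws} {u = u} {bs} refl (ws≤w ∷ desc) (w≤u ∷ _) (p ∷ f) ok
  with t ← All.lookup (all⁺ _ (upTo (suc u)) (≡true⇒T ok)) (∈-upTo⁺ (s≤s w≤u))
  -- The pruning test cannot reject an actual filling: the blocks have the same total as the
  -- weights, none of which exceeds the first one, `w`.
  rewrite ≤⇒≤ᵇ≡true (subst (_≤ suc (length ws) * w) (sym (fill⇒sum (p ∷ f)))
                            (sum≤length* (ℕ.≤-refl ∷ ws≤w)))
  = everyFill-sound refl desc ws≤w f
      (T⇒≡true (All.lookup (all⁺ _ (placements w bs) t) (place⇒∈placements p)))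

-- Cuts of a topologically numbered graph

module TopologicallyNumbered (D : Digraph)
  (increasing : ∀ e → toℕ (Digraph.src D e) < toℕ (Digraph.tgt D e)) where
  open Digraph D

  closure-increasing : ∀ {u v} → TransClosure Edge u v → toℕ u < toℕ v
  closure-increasing [ e , refl , refl ]       = increasing e
  closure-increasing ((e , refl , refl) ∷ e⁺) = ℕ.<-trans (increasing e) (closure-increasing e⁺)

  numbered⇒acyclic : Acyclic
  numbered⇒acyclic v = ℕ.<-irrefl refl ∘ closure-increasing

  Cut : ℕ → E → Set
  Cut c e = toℕ (src e) ≤ c × c < toℕ (tgt e)

  cut? : ∀ c e → Dec (Cut c e)
  cut? c e = toℕ (src e) ℕ.≤? c ×-dec c ℕ.<? toℕ (tgt e)

  cut : ℕ → List E
  cut c = filter (cut? c) (allFin ∣E∣)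

  -- Vertex numbers grow along a walk, so a walk that starts past `c` never uses an edge whose tail
  -- is at most `c`.
  crosses-beyond : ∀ {u v c f} (p : Walk u v) → c < toℕ u → Cut c f → crosses p f ≡ false
  crosses-beyond ε _ _ = refl
  crosses-beyond {f = f} ((e , refl , refl) ◅ p) c<e f∈cut with f ≟ e
  ... | yes refl = contradiction (proj₁ f∈cut) (ℕ.<⇒≱ c<e)
  ... | no  _    = crosses-beyond p (ℕ.<-trans c<e (increasing e)) f∈cut

  -- The edge is the first one of the walk whose head exceeds `c`. The form `does (f ≟ e)` turns the
  -- path flow on the cut into the indicator of a single edge, as `place-at` requires.
  crosses-once : ∀ {u v c} (p : Walk u v) → toℕ u ≤ c → c < toℕ v →
                 ∃ λ e → Cut c e × (∀ {f} → Cut c f → crosses p f ≡ does (f ≟ e))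
  crosses-once ε v≤c c<v = contradiction v≤c (ℕ.<⇒≱ c<v)
  crosses-once {c = c} ((e , refl , refl) ◅ p) e≤c c<v with c ℕ.<? toℕ (tgt e)
  ... | yes c<e = e , (e≤c , c<e) , only-e
    where
    only-e : ∀ {f} → Cut c f → crosses ((e , refl , refl) ◅ p) f ≡ does (f ≟ e)
    only-e {f} f∈cut with f ≟ e
    ... | yes _ = refl
    ... | no  _ = crosses-beyond p c<e f∈cut
  ... | no  c≮e with e′ , e′∈cut , once ← crosses-once p (ℕ.≮⇒≥ c≮e) c<v = e′ , e′∈cut , later
    where
    later : ∀ {f} → Cut c f → crosses ((e , refl , refl) ◅ p) f ≡ does (f ≟ e′)
    later {f} f∈cut with f ≟ e
    ... | yes refl = contradiction (proj₂ f∈cut) c≮e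
    ... | no  _    = once f∈cut

-- As `es` has no repetitions, subtracting `w` times the indicator of `e` affects exactly one block.
place-at : ∀ {es : List (Fin n)} {e X X′} → Unique es → e ∈ es →
           (∀ {f} → f ∈ es → X f ≡ w * (if does (f ≟ e) then 1 else 0) + X′ f) →
           Place w (map X es) (map X′ es)
place-at {w = w} {es = e ∷ es} {X = X} {X′} (e∉es ∷ _) (here refl) X≡ =
  subst (λ bs → Place w bs (X′ e ∷ map X′ es)) (cong₂ _∷_ (sym at-e) (sym elsewhere)) here
  where
  at-e : X e ≡ w + X′ e
  at-e with X≡ (here refl)
  ... | eq rewrite dec-true (e ≟ e) refl = trans eq (cong (_+ X′ e) (ℕ.*-identityʳ w))
  elsewhere : map X es ≡ map X′ es
  elsewhere = map-cong-local (All.tabulate λ {f} f∈es → unchanged f∈es (X≡ (there f∈es)))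
    where
    unchanged : ∀ {f} → f ∈ es → X f ≡ w * (if does (f ≟ e) then 1 else 0) + X′ f → X f ≡ X′ f
    unchanged {f} f∈es eq rewrite dec-false (f ≟ e) (All.lookup e∉es f∈es ∘ sym) | ℕ.*-zeroʳ w = eq
place-at {w = w} {es = f ∷ es} {e} {X} {X′} (f∉es ∷ es!) (there e∈es) X≡ =
  subst (λ b → Place w (b ∷ map X es) (X′ f ∷ map X′ es)) (sym at-f)
        (there (place-at es! e∈es (X≡ ∘ there)))
  where
  at-f : X f ≡ X′ f
  at-f with X≡ (here refl)
  ... | eq rewrite dec-false (f ≟ e) (All.lookup f∉es e∈es) | ℕ.*-zeroʳ w = eq

-- A decomposition as a list of weighted paths

module Weighted (G : STDAG)
  (increasing : ∀ e → toℕ (STDAG.src G e) < toℕ (STDAG.tgt G e)) where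
  open STDAG G
  open TopologicallyNumbered digraph increasing

  load : List (ℕ × Path G) → E → ℕ
  load xs e = sum (map (λ (w , P) → w * pathFlow G P e) xs)

  weights : List (ℕ × Path G) → List ℕ
  weights = map proj₁

  load-tabulate : (x : Vector (ℕ × Path G) k) (e : E) →
    load (tabulate x) e ≡ ℕΣ.sum (λ j → proj₁ (x j) * pathFlow G (proj₂ (x j)) e)
  load-tabulate {zero}  x e = refl
  load-tabulate {suc k} x e =
    cong (proj₁ (x zero) * pathFlow G (proj₂ (x zero)) e +_) (load-tabulate (x ∘ suc) e)

  fill-cut : ∀ {c} → toℕ s ≤ c → c < toℕ t → ∀ xs → Fill (weights xs) (map (load xs) (cut c))
  fill-cut {c} s≤c c<t [] = [] (zeros (cut c))
    where
    zeros : ∀ es → All (T ∘ (_≡ᵇ 0)) (map (load []) es)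
    zeros []       = []
    zeros (_ ∷ es) = tt ∷ zeros es
  fill-cut {c} s≤c c<t ((w , P) ∷ xs)
    with e , e∈cut , once ← crosses-once P s≤c c<t =
    place-at (filter⁺ (cut? c) (allFin⁺ ∣E∣)) (∈-filter⁺ (cut? c) (∈-allFin e) e∈cut)
      (λ {f} f∈ → cong (λ b → w * (if b then 1 else 0) + load xs f)
                       (once (proj₂ (∈-filter⁻ (cut? c) {xs = allFin ∣E∣} f∈))))
    ∷ fill-cut s≤c c<t xs

  heaviest-first : DecTotalOrder _ _ _
  heaviest-first = On.decTotalOrder (Flip.decTotalOrder ℕ.≤-decTotalOrder) (proj₁ {B = λ _ → Path G})

  open Sort heaviest-first using (sort; sort-↭; sort-↗)

  -- One sorted list of weights serves all cuts at once, which is what lets the cuts be tested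
  -- against each other. Whole weighted paths are sorted, so each weight stays with its path.
  decomposition⇒fills : ∀ {X} → FlowDecomposition G X k →
    ∃ λ ws → length ws ≡ k × AllPairs _≥_ ws ×
             (∀ {c} → toℕ s ≤ c → c < toℕ t → Fill ws (map X (cut c)))
  decomposition⇒fills {k} {X} (P , w , solves) =
    weights xs , length-ws , AllPairs.map⁺ (Sorted⇒AllPairs totalOrder (sort-↗ xs₀)) , fills
    where
    open DecTotalOrder heaviest-first using (totalOrder)
    xs₀ = tabulate (λ j → w j , P j)
    xs  = sort xs₀
    length-ws : length (weights xs) ≡ k
    length-ws = trans (length-map proj₁ xs) (trans (↭-length (sort-↭ xs₀)) (length-tabulate _))
    load≗X : load xs ≗ X
    load≗X e = trans (sum-↭ (map⁺ _ (sort-↭ xs₀))) (trans (load-tabulate (λ j → w j , P j) e) (solves e))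
    fills : ∀ {c} → toℕ s ≤ c → c < toℕ t → Fill (weights xs) (map X (cut c))
    fills {c} s≤c c<t = subst (Fill (weights xs)) (map-cong load≗X (cut c)) (fill-cut s≤c c<t xs)

  widen : ∀ {X} → Path G → FlowDecomposition G X k → FlowDecomposition G X (suc k)
  widen P₀ (P , w , solves) =
    -- The new path has weight 0, so its term in each edge equation reduces to 0 and the old proof
    -- still applies.
    (λ { zero → P₀ ; (suc j) → P j }) , (λ { zero → 0 ; (suc j) → w j }) , solves

  widen* : ∀ {X} → Path G → k ≤ m → FlowDecomposition G X k → FlowDecomposition G X m
  widen* P₀ k≤m = go (ℕ.≤⇒≤′ k≤m)
    where
    go : ∀ {X k m} → k ≤′ m → FlowDecomposition G X k → FlowDecomposition G X m
    go ≤′-refl     D = D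
    go (≤′-step p) D = widen P₀ (go p D)

-- Rational linear relations

sum-single : (i : Fin n) (x : ℚ) (f : Vector ℚ n) →
             ℚΣ.sum (λ j → (if does (i ≟ j) then x else 0ℚ) ℚ.* f j) ≡ x ℚ.* f i
sum-single {suc n} zero x f = begin
  x ℚ.* f zero ℚ.+ ℚΣ.sum (λ j → 0ℚ ℚ.* f (suc j))
    ≡⟨ cong (x ℚ.* f zero ℚ.+_) (ℚΣ.sum-cong-≗ (λ j → ℚ.*-zeroˡ (f (suc j)))) ⟩
  x ℚ.* f zero ℚ.+ ℚΣ.sum {n} (λ _ → 0ℚ)
    ≡⟨ cong (x ℚ.* f zero ℚ.+_) (ℚΣ.sum-replicate-zero n) ⟩
  x ℚ.* f zero ℚ.+ 0ℚ
    ≡⟨ ℚ.+-identityʳ _ ⟩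
  x ℚ.* f zero
    ∎
  where open ≡-Reasoning
sum-single {suc n} (suc i) x f = begin
  0ℚ ℚ.* f zero ℚ.+ rest   ≡⟨ cong (ℚ._+ rest) (ℚ.*-zeroˡ (f zero)) ⟩
  0ℚ ℚ.+ rest              ≡⟨ ℚ.+-identityˡ rest ⟩
  rest                     ≡⟨ sum-single i x (f ∘ suc) ⟩
  x ℚ.* f (suc i)          ∎
  where
  open ≡-Reasoning
  rest = ℚΣ.sum (λ j → (if does (i ≟ j) then x else 0ℚ) ℚ.* f (suc j))

independent⇒injective : (v : Fin n → Vector ℚ m) → LinearlyIndependent v →
                        ∀ {i j} → v i ≗ v j → i ≡ j
independent⇒injective {n} v indep {i} {j} vi≗vj with i ≟ j
... | yes i≡j = i≡j
... | no  i≢j = contradiction (trans (sym aᵢ≡1) (indep a relation i)) λ ()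
  where
  open ≡-Reasoning
  single : Fin n → ℚ → Vector ℚ n
  single i x k = if does (i ≟ k) then x else 0ℚ
  -- The coefficients of `v i - v j`, a vanishing combination with coefficient 1 at `i`.
  a : Vector ℚ n
  a k = single i 1ℚ k ℚ.+ single j (ℚ.- 1ℚ) k
  aᵢ≡1 : a i ≡ 1ℚ
  aᵢ≡1 rewrite dec-true (i ≟ i) refl | dec-false (j ≟ i) (i≢j ∘ sym) = refl
  relation : ∀ e → ℚΣ.sum (λ k → a k ℚ.* v k e) ≡ 0ℚ
  relation e = begin
    ℚΣ.sum (λ k → a k ℚ.* v k e)
      ≡⟨ ℚΣ.sum-cong-≗ (λ k → ℚ.*-distribʳ-+ (v k e) (single i 1ℚ k) (single j (ℚ.- 1ℚ) k)) ⟩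
    ℚΣ.sum (λ k → single i 1ℚ k ℚ.* v k e ℚ.+ single j (ℚ.- 1ℚ) k ℚ.* v k e)
      ≡⟨ ℚΣ.∑-distrib-+ (λ k → single i 1ℚ k ℚ.* v k e) (λ k → single j (ℚ.- 1ℚ) k ℚ.* v k e) ⟩
    ℚΣ.sum (λ k → single i 1ℚ k ℚ.* v k e) ℚ.+ ℚΣ.sum (λ k → single j (ℚ.- 1ℚ) k ℚ.* v k e)
      ≡⟨ cong₂ ℚ._+_ (sum-single i 1ℚ (λ k → v k e)) (sum-single j (ℚ.- 1ℚ) (λ k → v k e)) ⟩
    1ℚ ℚ.* v i e ℚ.+ ℚ.- 1ℚ ℚ.* v j e
      ≡⟨ cong (λ y → 1ℚ ℚ.* v i e ℚ.+ ℚ.- 1ℚ ℚ.* y) (vi≗vj e) ⟨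
    1ℚ ℚ.* v i e ℚ.+ ℚ.- 1ℚ ℚ.* v i e
      ≡⟨ ℚ.*-distribʳ-+ (v i e) 1ℚ (ℚ.- 1ℚ) ⟨
    0ℚ ℚ.* v i e
      ≡⟨ ℚ.*-zeroˡ (v i e) ⟩
    0ℚ ∎

-- If `y` were missed, punching it out would inject `Fin q` into `Fin n`.
injective⇒surjective : {c : Fin q → Fin (suc n)} → Injective _≡_ _≡_ c → n < q →
                       ∀ y → ∃ λ i → c i ≡ y
injective⇒surjective {c = c} c-inj n<q y with Fin.any? (λ i → c i ≟ y)
... | yes hit  = hit
... | no  miss = contradiction
  (Fin.injective⇒≤ {f = λ i → punchOut (y≢c i)} (c-inj ∘ Fin.punchOut-injective (y≢c _) (y≢c _)))
  (ℕ.<⇒≱ n<q)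
  where
  y≢c : ∀ i → y ≢ c i
  y≢c i y≡ci = miss (i , sym y≡ci)

-- q columns can only be independent for q > n if they are a permutation of
-- all n + 1 columns, and then the relation d applies to them.
relation⇒independent≤ : (M : Fin m → Fin (suc n) → ℚ) (d : Vector ℚ (suc n)) →
  (∀ j → d j ≢ 0ℚ) → (∀ e → ℚΣ.sum (λ j → d j ℚ.* M e j) ≡ 0ℚ) →
  (c : Fin q → Fin (suc n)) → IndependentColumns M c → q ≤ n
relation⇒independent≤ M d d≢0 Md≡0 c indep = ℕ.≮⇒≥ λ n<q →
  let surj = injective⇒surjective c-inj n<q
      π    = permutation c (proj₁ ∘ surj) (proj₂ ∘ surj) (λ i → c-inj (proj₂ (surj (c i))))
      d∘c≡0 = indep (d ∘ c) λ e →
        trans (sym (ℚΣ.sum-permute (λ j → d j ℚ.* M e j) π)) (Md≡0 e)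
  in d≢0 _ (d∘c≡0 (proj₁ (surj zero)))
  where
  c-inj : Injective _≡_ _≡_ c
  c-inj ci≡cj = independent⇒injective (λ j e → M e (c j)) indep (λ e → cong (M e) ci≡cj)

x+x≡0⇒x≡0 : ∀ x → x ℚ.+ x ≡ 0ℚ → x ≡ 0ℚ
x+x≡0⇒x≡0 x x+x≡0 = begin
  x                       ≡⟨ ℚ.*-identityˡ x ⟨
  (½ ℚ.+ ½) ℚ.* x         ≡⟨ ℚ.*-distribʳ-+ x ½ ½ ⟩
  ½ ℚ.* x ℚ.+ ½ ℚ.* x     ≡⟨ ℚ.*-distribˡ-+ ½ x x ⟨
  ½ ℚ.* (x ℚ.+ x)         ≡⟨ cong (½ ℚ.*_) x+x≡0 ⟩
  ½ ℚ.* 0ℚ                ≡⟨ ℚ.*-zeroʳ ½ ⟩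
  0ℚ                      ∎
  where open ≡-Reasoning

-- For concrete `b` this reduces to the selected coefficients alone, so a row of the path matrix
-- becomes a short explicit equation.
selectedSum : (Fin n → Bool) → Vector ℚ n → ℚ
selectedSum {zero}  b a = 0ℚ
selectedSum {suc n} b a = if b zero then a zero ℚ.+ later else later
  where later = selectedSum (b ∘ suc) (a ∘ suc)

sum-indicator : (b : Fin n → Bool) (a : Vector ℚ n) →
                ℚΣ.sum (λ j → a j ℚ.* (if b j then 1ℚ else 0ℚ)) ≡ selectedSum b a
sum-indicator {zero}  b a = refl
sum-indicator {suc n} b a with b zero | sum-indicator (b ∘ suc) (a ∘ suc)
... | true  | eq = cong₂ ℚ._+_ (ℚ.*-identityʳ (a zero)) eq
... | false | eq = trans (cong₂ ℚ._+_ (ℚ.*-zeroʳ (a zero)) eq) (ℚ.+-identityˡ _)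

-- The graph is a chain of hubs 0, 3, 6, 9, 12, 15. From each hub to the next
-- there are a direct edge and two detours, through the vertices h + 1 and
-- h + 2; one further edge 0 → 6 runs past hub 3. Edges 5i, …, 5i + 4 lie
-- between hubs 3i and 3i + 3, and edge 25 is the long one.

ends : Vec (Fin 16 × Fin 16) 26
ends =
  (# 0  , # 3)  ∷ (# 0  , # 1)  ∷ (# 0  , # 2)  ∷ (# 1  , # 3)  ∷ (# 2  , # 3)  ∷
  (# 3  , # 6)  ∷ (# 3  , # 4)  ∷ (# 3  , # 5)  ∷ (# 4  , # 6)  ∷ (# 5  , # 6)  ∷
  (# 6  , # 9)  ∷ (# 6  , # 7)  ∷ (# 6  , # 8)  ∷ (# 7  , # 9)  ∷ (# 8  , # 9)  ∷
  (# 9  , # 12) ∷ (# 9  , # 10) ∷ (# 9  , # 11) ∷ (# 10 , # 12) ∷ (# 11 , # 12) ∷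
  (# 12 , # 15) ∷ (# 12 , # 13) ∷ (# 12 , # 14) ∷ (# 13 , # 15) ∷ (# 14 , # 15) ∷
  (# 0  , # 6)  ∷ []

D : Digraph
D = record
  { ∣V∣    = 16
  ; ∣E∣    = 26
  ; src    = proj₁ ∘ lookup ends
  ; tgt    = proj₂ ∘ lookup ends
  ; simple = from-yes (Fin.all? λ e → Fin.all? λ f →
      (proj₁ (lookup ends e) ≟ proj₁ (lookup ends f)) →-dec
      ((proj₂ (lookup ends e) ≟ proj₂ (lookup ends f)) →-dec (e ≟ f)))
  }

D-increasing : ∀ e → toℕ (Digraph.src D e) < toℕ (Digraph.tgt D e)
D-increasing = from-yes (Fin.all? λ e → toℕ (Digraph.src D e) ℕ.<? toℕ (Digraph.tgt D e))

G : STDAG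
G = record
  { digraph  = D
  ; acyclic  = TopologicallyNumbered.numbered⇒acyclic D D-increasing
  ; s        = # 0
  ; t        = # 15
  ; s-source = from-yes (Fin.all? λ e → ¬? (tgt e ≟ # 0))
  ; s-unique = from-yes (Fin.all? λ v → Fin.all? (λ e → ¬? (tgt e ≟ v)) →-dec (v ≟ # 0))
  ; t-sink   = from-yes (Fin.all? λ e → ¬? (src e ≟ # 15))
  ; t-unique = from-yes (Fin.all? λ v → Fin.all? (λ e → ¬? (src e ≟ v)) →-dec (v ≟ # 15))
  }
  where open Digraph D

-- The flow, its eight paths and two solutions

open STDAG G using (E; s; t; src; tgt; Walk; crosses)

X : E → ℕ
X = lookup
  ( 6  ∷ 58 ∷ 14 ∷ 58 ∷ 14 ∷
    42 ∷ 31 ∷ 5  ∷ 31 ∷ 5  ∷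
    43 ∷ 24 ∷ 15 ∷ 24 ∷ 15 ∷
    16 ∷ 25 ∷ 41 ∷ 25 ∷ 41 ∷
    52 ∷ 8  ∷ 22 ∷ 8  ∷ 22 ∷
    4  ∷ [])

X-flow : IsFlow G X
X-flow = from-yes (Fin.all? λ v →
  ¬? (v ≟ s) →-dec (¬? (v ≟ t) →-dec (inflow G X v ℕ.≟ outflow G X v)))

-- Lets a path be given by its edge numbers; `from-just` yields a path only if the edges do form a
-- walk.
walk? : ∀ u v → List E → Maybe (Walk u v)
walk? u v [] with u ≟ v
... | yes refl = just ε
... | no  _    = nothing
walk? u v (e ∷ es) with src e ≟ u
... | yes refl = Maybe.map ((e , refl , refl) ◅_) (walk? (tgt e) v es)
... | no  _    = nothing

paths : Vec (Path G) 8
paths =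
  from-just (walk? s t (# 25 ∷                       # 10        ∷ # 15        ∷ # 20        ∷ [])) ∷
  from-just (walk? s t (# 25 ∷                       # 11 ∷ # 13 ∷ # 16 ∷ # 18 ∷ # 21 ∷ # 23 ∷ [])) ∷
  from-just (walk? s t (# 0        ∷ # 5           ∷ # 12 ∷ # 14 ∷ # 16 ∷ # 18 ∷ # 21 ∷ # 23 ∷ [])) ∷
  from-just (walk? s t (# 1 ∷ # 3  ∷ # 6 ∷ # 8     ∷ # 11 ∷ # 13 ∷ # 16 ∷ # 18 ∷ # 22 ∷ # 24 ∷ [])) ∷
  from-just (walk? s t (# 2 ∷ # 4  ∷ # 7 ∷ # 9     ∷ # 11 ∷ # 13 ∷ # 17 ∷ # 19 ∷ # 21 ∷ # 23 ∷ [])) ∷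
  from-just (walk? s t (# 0        ∷ # 7 ∷ # 9     ∷ # 10        ∷ # 15        ∷ # 22 ∷ # 24 ∷ [])) ∷
  from-just (walk? s t (# 1 ∷ # 3  ∷ # 5           ∷ # 10        ∷ # 17 ∷ # 19 ∷ # 20        ∷ [])) ∷
  from-just (walk? s t (# 2 ∷ # 4  ∷ # 6 ∷ # 8     ∷ # 12 ∷ # 14 ∷ # 15        ∷ # 20        ∷ [])) ∷
  []

P : Vector (Path G) 8
P = lookup paths

-- The members x = 0 and x = 1 of the family of solutions.
w₁ w₂ : Vector ℕ 8
w₁ = lookup (1 ∷ 3 ∷ 3 ∷ 19 ∷ 2 ∷ 3 ∷ 39 ∷ 12 ∷ [])
w₂ = lookup (3 ∷ 1 ∷ 4 ∷ 20 ∷ 3 ∷ 2 ∷ 38 ∷ 11 ∷ [])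

solves? : ∀ {k} (Q : Vector (Path G) k) w → Dec (Solves G X Q w)
solves? Q w = Fin.all? λ e → ℕΣ.sum (λ j → w j * pathFlow G (Q j) e) ℕ.≟ X e

w₁-solves : Solves G X P w₁
w₁-solves = from-yes (solves? P w₁)

w₂-solves : Solves G X P w₂
w₂-solves = from-yes (solves? P w₂)

-- Minimality of the decomposition

open TopologicallyNumbered D D-increasing using (cut)
open Weighted G D-increasing

-- stageᵢ is map X (cut (3 * i)), written out because the evaluation of
-- everyFill would otherwise recompute the cuts at every leaf of the search.
stage₀ stage₁ stage₂ stage₃ stage₄ : List ℕ
stage₀ = 6  ∷ 58 ∷ 14 ∷ 4 ∷ []
stage₁ = 42 ∷ 31 ∷ 5  ∷ 4 ∷ []
stage₂ = 43 ∷ 24 ∷ 15 ∷ []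
stage₃ = 16 ∷ 25 ∷ 41 ∷ []
stage₄ = 52 ∷ 8  ∷ 22 ∷ []

-- `stage₀` is absent because `everyFill` already runs over the lists that fill it.
refuted : List ℕ → Bool
refuted ws = not (fits ws stage₁ ∧ fits ws stage₄ ∧ fits ws stage₃ ∧ fits ws stage₂)

-- The total flow 82 = 6 + 58 + 14 + 4 bounds every weight. The finite search is the evaluation of
-- this equation.
every-refuted : everyFill 7 82 stage₀ refuted ≡ true
every-refuted = refl

fills⇒¬refuted : Fill ws stage₁ → Fill ws stage₂ → Fill ws stage₃ → Fill ws stage₄ →
                 ¬ T (refuted ws)
fills⇒¬refuted f₁ f₂ f₃ f₄
  rewrite T⇒≡true (fill⇒fits f₁) | T⇒≡true (fill⇒fits f₂)
        | T⇒≡true (fill⇒fits f₃) | T⇒≡true (fill⇒fits f₄) = id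

unfillable : length ws ≡ 7 → AllPairs _≥_ ws →
             Fill ws stage₀ → Fill ws stage₁ → Fill ws stage₂ → Fill ws stage₃ → ¬ Fill ws stage₄
unfillable {ws} length≡7 desc f₀ f₁ f₂ f₃ f₄ =
  fills⇒¬refuted f₁ f₂ f₃ f₄ (everyFill-sound {p = refuted} length≡7 desc ws≤82 f₀ every-refuted)
  where
  ws≤82 : All (_≤ 82) ws
  ws≤82 = subst (λ n → All (_≤ n) ws) (sym (fill⇒sum f₀)) (all≤sum ws)

¬decomposition₇ : ¬ FlowDecomposition G X 7
¬decomposition₇ dec =
  let _ , length≡7 , desc , fills = decomposition⇒fills dec
  in unfillable length≡7 desc
       -- The argument of `z≤n` fixes the cut; the sums 1 + 14, 4 + 11 and so on are all 15, the
       -- number of `t`.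
       (fills (z≤n {0})  (ℕ.m≤m+n 1 14)) (fills (z≤n {3}) (ℕ.m≤m+n 4 11))
       (fills (z≤n {6})  (ℕ.m≤m+n 7 8))  (fills (z≤n {9}) (ℕ.m≤m+n 10 5))
       (fills (z≤n {12}) (ℕ.m≤m+n 13 2))

-- A decomposition with fewer than 8 paths can be padded with paths of weight 0 to size exactly 7.
minimal : ∀ l → FlowDecomposition G X l → 8 ≤ l
minimal l dec = ℕ.≮⇒≥ λ l<8 → ¬decomposition₇ (widen* (P zero) (s≤s⁻¹ l<8) dec)

-- Rank of the path matrix

columns₁₋₇-independent : IndependentColumns (pathMatrix G P) suc
-- Edges 0, 5 and 10 give a₂ + a₅ = a₂ + a₆ = a₅ + a₆ = 0, so all three vanish. Edge 25 meets only
-- column 1 of the family, and edges 1, 7 and 6 then yield a₃, a₄ and a₇.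
columns₁₋₇-independent a relation = λ where
    zero                                     → trans (sym (ℚ.+-identityʳ _)) (on (# 25))
    (suc zero)                               → a₂≡0
    (suc (suc zero))                         → a₃≡0
    (suc (suc (suc zero)))                   → zeroˡ _ (on (# 7)) a₅≡0
    (suc (suc (suc (suc zero))))             → a₅≡0
    (suc (suc (suc (suc (suc zero)))))       → a₆≡0
    (suc (suc (suc (suc (suc (suc zero)))))) → zeroʳ _ (on (# 6)) a₃≡0
  where
  on : ∀ e → selectedSum (λ j → crosses (P (suc j)) e) a ≡ 0ℚ
  on e = trans (sym (sum-indicator (λ j → crosses (P (suc j)) e) a)) (relation e)

  zeroˡ : ∀ x {y} → x ℚ.+ (y ℚ.+ 0ℚ) ≡ 0ℚ → y ≡ 0ℚ → x ≡ 0ℚ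
  zeroˡ x eq refl = trans (sym (ℚ.+-identityʳ x)) eq

  zeroʳ : ∀ {x} y → x ℚ.+ (y ℚ.+ 0ℚ) ≡ 0ℚ → x ≡ 0ℚ → y ≡ 0ℚ
  zeroʳ y eq refl = trans (sym (trans (ℚ.+-identityˡ _) (ℚ.+-identityʳ y))) eq

  cancel : ∀ x y z → x ℚ.+ (y ℚ.+ 0ℚ) ≡ 0ℚ → x ℚ.+ (z ℚ.+ 0ℚ) ≡ 0ℚ → y ≡ z
  cancel x y z eq₁ eq₂ = begin
    y         ≡⟨ ℚ.+-identityʳ y ⟨
    y ℚ.+ 0ℚ  ≡⟨ ℚGroup.∙-cancelˡ x (y ℚ.+ 0ℚ) (z ℚ.+ 0ℚ) (trans eq₁ (sym eq₂)) ⟩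
    z ℚ.+ 0ℚ  ≡⟨ ℚ.+-identityʳ z ⟩
    z         ∎
    where open ≡-Reasoning

  -- aⱼ is the coefficient of column j, which is column j − 1 of the family suc.
  a₅ = a (# 4)
  a₆ = a (# 5)

  a₅≡a₆ : a₅ ≡ a₆
  a₅≡a₆ = cancel (a (# 1)) a₅ a₆ (on (# 0)) (on (# 5))

  a₅≡0 : a₅ ≡ 0ℚ
  a₅≡0 = x+x≡0⇒x≡0 a₅ (trans (cong (a₅ ℚ.+_) (trans a₅≡a₆ (sym (ℚ.+-identityʳ a₆)))) (on (# 10)))

  a₆≡0 : a₆ ≡ 0ℚ
  a₆≡0 = trans (sym a₅≡a₆) a₅≡0

  a₂≡0 : a (# 1) ≡ 0ℚ
  a₂≡0 = zeroˡ _ (on (# 0)) a₅≡0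

  a₃≡0 : a (# 2) ≡ 0ℚ
  a₃≡0 = zeroˡ _ (on (# 1)) a₆≡0

kernel : Vector ℚ 8
kernel = lookup (2ℚ ∷ ℚ.- 2ℚ ∷ 1ℚ ∷ 1ℚ ∷ 1ℚ ∷ ℚ.- 1ℚ ∷ ℚ.- 1ℚ ∷ ℚ.- 1ℚ ∷ [])
  where 2ℚ = 1ℚ ℚ.+ 1ℚ

rank≡7 : IsRank (pathMatrix G P) 7
rank≡7 =
  (suc , columns₁₋₇-independent) ,
  λ q → relation⇒independent≤ (pathMatrix G P) kernel
    (from-yes (Fin.all? λ j → ¬? (kernel j ℚ.≟ 0ℚ)))
    (from-yes (Fin.all? λ e → ℚΣ.sum (λ j → kernel j ℚ.* pathMatrix G P e j) ℚ.≟ 0ℚ))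

mainTheorem5 : Σ STDAG λ G → Σ (STDAG.E G → ℕ) λ X → IsFlow G X ×
    (Σ ℕ λ k → Σ (Vector (Path G) k) λ P →
    ArePathsOfMinimumDecomposition G X P ×
    (Σ (Vector ℕ k) λ w → Σ (Vector ℕ k) λ w′ →
    Solves G X P w × Solves G X P w′ × ¬ (w ≗ w′)) ×
    (Σ ℕ λ r → IsRank (pathMatrix G P) r × r < k))
mainTheorem5 =
  G , X , X-flow , 8 , P ,
  ((w₁ , w₁-solves) , (P , w₁ , w₁-solves) , minimal) ,
  (w₁ , w₂ , w₁-solves , w₂-solves , λ w₁≗w₂ → contradiction (w₁≗w₂ zero) λ ()) ,
  7 , rank≡7 , ℕ.≤-refl
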